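{- Let $k\in\mathbb{N}$. If $k\ge 5$, then every $4$-dimensional grid is equitably $k$-list arborable.
   Context: $P_n$ denotes the path on $n$ vertices and $\square$ the Cartesian product. A $4$-dimensional grid is $P_{n_1}\square P_{n_2}\square P_{n_3}\square P_{n_4}$ with every $n_i\ge 2$. A $k$-uniform list assignment $L$ for $G$ assigns to each vertex $v$ a set $L(v)$ of exactly $k$ colours; an $L$-colouring is a map $c$ with $c(v)\in L(v)$; it is equitable if every colour class has at most $\lceil |V(G)|/k\rceil$ vertices. $G$ is equitably $k$-list arborable if for every $k$-uniform list assignment $L$ there is an equitable $L$-colouring of $G$ in which every colour class induces an acyclic subgraph. -}

module Defs where

open import Data.Nat using (ℕ; zero; suc; _+_; _≤_; _<_; _≟_)
open import Data.Nat.DivMod using (_/_)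
open import Data.Fin using (Fin; toℕ)
open import Data.List using (List; length; filter; allFin; cartesianProduct; map; lookup)
open import Data.List.Membership.Propositional using (_∈_)
open import Data.List.Relation.Unary.Unique.Propositional using (Unique)
open import Data.Product using (_×_; _,_; Σ; ∃)
open import Data.Sum using (_⊎_)
open import Relation.Binary.PropositionalEquality using (_≡_)

-- A finite simple graph given by a vertex type, an adjacency relation,
-- and an explicit enumeration of its vertices (each vertex listed once).
record Graph : Set₁ where
  field
    V     : Set
    Adj   : V → V → Set
    verts : List V
open Graph public

PathAdj : ∀ {n} → Fin n → Fin n → Set
PathAdj i j = (toℕ j ≡ suc (toℕ i)) ⊎ (toℕ i ≡ suc (toℕ j))

P : ℕ → Graph
P n = record { V = Fin n ; Adj = PathAdj ; verts = allFin n }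

_□_ : Graph → Graph → Graph
G □ H = record
  { V     = V G × V H
  ; Adj   = λ { (x , y) (x′ , y′) → (Adj G x x′ × y ≡ y′) ⊎ (x ≡ x′ × Adj H y y′) }
  ; verts = cartesianProduct (verts G) (verts H)
  }
infixr 6 _□_

-- ⌈ m / k ⌉ (for k ≥ 1; the value for k = 0 is irrelevant)
ceilDiv : ℕ → ℕ → ℕ
ceilDiv m zero    = 0
ceilDiv m (suc k) = (m + k) / suc k

ListAssignment : Graph → ℕ → Set
ListAssignment G k =
  Σ (V G → List ℕ) λ L → ∀ v → Unique (L v) × length (L v) ≡ k

classSize : (G : Graph) → (V G → ℕ) → ℕ → ℕ
classSize G c a = length (filter (λ v → c v ≟ a) (verts G))

record CycleIn (G : Graph) (S : V G → Set) : Set where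
  field
    cyc      : List (V G)
    long     : 3 ≤ length cyc
    distinct : Unique cyc
    inS      : ∀ {v} → v ∈ cyc → S v
    adjacent : ∀ (i : Fin (length cyc)) →
               (p : suc (toℕ i) < length cyc) →
               Adj G (lookup cyc i) (lookup cyc (Data.Fin.fromℕ< p))
    closing  : (p : 0 < length cyc) (q : (length cyc Data.Nat.∸ 1) < length cyc) →
               Adj G (lookup cyc (Data.Fin.fromℕ< q)) (lookup cyc (Data.Fin.fromℕ< p))

InducesAcyclic : (G : Graph) → (V G → Set) → Set
InducesAcyclic G S = CycleIn G S → Data.Empty.⊥
  where import Data.Empty

EquitablyListArborable : Graph → ℕ → Set
EquitablyListArborable G k =
  (LA : ListAssignment G k) →
  let L = Data.Product.proj₁ LA in
  Σ (V G → ℕ) λ c →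
      (∀ v → c v ∈ L v)
    × (∀ a → classSize G c a ≤ ceilDiv (length (verts G)) k)
    × (∀ a → InducesAcyclic G (λ v → c v ≡ a))

Grid4 : ℕ → ℕ → ℕ → ℕ → Graph
Grid4 n₁ n₂ n₃ n₄ = P n₁ □ P n₂ □ P n₃ □ P n₄

-- Let S be a block of k vertices x₁, …, x_k such that x_i has at most 2i ∸ 1 neighbours
-- outside S.  Then a colouring of the remaining graph extends to S: colour x_k, …, x₁ in turn,
-- with distinct colours; x_i has at least i colours left, and one of them occurs at most once
-- among the outside neighbours.  Classes grow by at most one, and no cycle is created, since
-- each vertex has at most one neighbour of its own colour among those coloured before its block.
--
-- From any finite set of points of ℕ⁴ with at least k ≥ 5 elements such a block can be
-- removed.  Let x be the lexicographically least point.  The block consists of x, the points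
-- x + e₂ and x + e₃ (e_i the unit vectors) if present,
-- the next two points y < z, and then the least points available.
-- A point below everything outside the block has at most 4 outside neighbours v + e_i; for
-- x and y the point v + e₄ is not outside, as it directly follows v in the order, which leaves
-- 1, 3 and 4 outside neighbours for x₁ = x, x₂ = y, x₃ = z; all other points of the block have
-- at most 7.
module Submission where

open import Defs
open import Data.Nat using (ℕ; zero; suc; pred; _+_; _∸_; _≤_; _<_; z≤n; s≤s; _≟_; _≤?_)
open import Data.Nat.DivMod using (_/_; m/n≡1+[m∸n]/n; m≥n⇒m/n>0)
open import Data.Nat.Properties
open import Data.Fin using (Fin; zero; suc; toℕ; fromℕ<)
open import Data.Fin.Properties using (fromℕ<-toℕ; toℕ-injective; toℕ-fromℕ<; toℕ<n)
import Algebra.Properties.CommutativeSemigroup as CommutativeSemigroupProperties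
open import Data.List using (List; []; _∷_; _++_; length; map; filter; take; drop; lookup; allFin; cartesianProduct)
open import Data.List.Properties using (length-++; length-map; filter-++; filter-accept; filter-reject; filter-notAll; length-take; take++drop≡id; partition-defn; ++-assoc; ++-identityʳ)
open import Data.List.Membership.Propositional using (_∈_)
open import Data.List.Membership.Propositional.Properties using (∈-filter⁺; ∈-filter⁻; ∈-++⁺ˡ; ∈-++⁺ʳ; ∈-++⁻; ∈-map⁺; ∈-map⁻; ∈-lookup; ∈-cartesianProduct⁺; ∈-cartesianProduct⁻; ∈-allFin)
import Data.List.Membership.DecPropositional as DecMembership
open import Data.List.Relation.Unary.Any as Any using (here; there)
open import Data.List.Relation.Unary.Any.Properties using (lookup-index)
open import Data.List.Relation.Unary.All as All using (All; []; _∷_)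
import Data.List.Relation.Unary.All.Properties as All
open import Data.List.Relation.Unary.AllPairs as AllPairs using (AllPairs; []; _∷_)
import Data.List.Relation.Unary.AllPairs.Properties as AllPairs
open import Data.List.Relation.Unary.Unique.Propositional using (Unique)
import Data.List.Relation.Unary.Unique.Propositional.Properties as Unique
open import Data.List.Relation.Binary.Permutation.Propositional using (_↭_; module PermutationReasoning; ↭-refl; ↭-sym; ↭-trans; ↭-prep; ↭-reflexive; ↭⇒↭ₛ; ↭ₛ⇒↭)
open import Data.List.Relation.Binary.Permutation.Propositional.Properties using (↭-length; ∈-resp-↭; filter-↭; shift)
import Data.List.Relation.Binary.Permutation.Setoid.Properties as Permutation
open import Data.List.Relation.Binary.Sublist.Propositional.Properties using (filter-⊆; length-mono-≤) renaming (filter⁺ to ⊆-filter⁺)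
open import Data.Product using (∃; ∃₂; _×_; _,_; proj₁; proj₂)
open import Data.Product.Properties using (≡-dec)
open import Data.Product.Relation.Binary.Lex.Strict using (×-Lex; ×-asymmetric)
open import Data.Sum using (_⊎_; inj₁; inj₂)
import Data.Sum as Sum
open import Data.Unit using (⊤; tt)
open import Function using (_∘_; _on_; case_of_)
open import Relation.Binary using (Decidable; DecidableEquality; Asymmetric)
open import Relation.Binary.PropositionalEquality using (_≡_; _≢_; refl; sym; trans; cong; cong₂; subst; setoid; resp₂; module ≡-Reasoning)
open import Relation.Nullary using (¬_; yes; no; contradiction)
open import Relation.Nullary.Decidable using (_⊎-dec_; ¬?)
import Relation.Unary as Unary
open import Relation.Unary.Properties using (∁?)

-- Counting in lists

module _ {A : Set} where

  module _ {Q : A → Set} (Q? : Unary.Decidable Q) where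

    filter-split-↭ : ∀ xs → xs ↭ filter Q? xs ++ filter (∁? Q?) xs
    filter-split-↭ xs =
      subst (λ p → xs ↭ proj₁ p ++ proj₂ p) (partition-defn Q? xs)
        (↭ₛ⇒↭ (Permutation.partition-↭ (setoid A) Q? xs))

    length-filter-split : ∀ xs → length xs ≡ length (filter Q? xs) + length (filter (∁? Q?) xs)
    length-filter-split xs = trans (↭-length (filter-split-↭ xs)) (length-++ (filter Q? xs))

    length-filter-map : ∀ {B : Set} (f : B → A) xs →
      length (filter Q? (map f xs)) ≡ length (filter (Q? ∘ f) xs)
    length-filter-map f []       = refl
    length-filter-map f (x ∷ xs) with Q? (f x)
    ... | yes _ = cong suc (length-filter-map f xs)
    ... | no  _ = length-filter-map f xs

    module _ {R : A → Set} (R? : Unary.Decidable R) where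

      length-filter-mono : ∀ {xs} → (∀ {x} → x ∈ xs → Q x → R x) →
        length (filter Q? xs) ≤ length (filter R? xs)
      length-filter-mono {[]}     imp = z≤n
      length-filter-mono {x ∷ xs} imp with Q? x | R? x
      ... | yes q | yes _ = s≤s (length-filter-mono (imp ∘ there))
      ... | yes q | no ¬r = contradiction (imp (here refl) q) ¬r
      ... | no  _ | yes _ = m≤n⇒m≤1+n (length-filter-mono (imp ∘ there))
      ... | no  _ | no  _ = length-filter-mono (imp ∘ there)

      filter-filter-⊆ : (∀ {x} → R x → Q x) → ∀ xs → filter R? (filter Q? xs) ≡ filter R? xs
      filter-filter-⊆ R⊆Q []       = refl
      filter-filter-⊆ R⊆Q (x ∷ xs) with Q? x
      ... | no ¬q = trans (filter-filter-⊆ R⊆Q xs) (sym (filter-reject R? (¬q ∘ R⊆Q)))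
      ... | yes _ with R? x
      ...   | yes _ = cong (x ∷_) (filter-filter-⊆ R⊆Q xs)
      ...   | no  _ = filter-filter-⊆ R⊆Q xs

  two-elements : ∀ {x y : A} {xs} → x ∈ xs → y ∈ xs → x ≢ y → 2 ≤ length xs
  two-elements (here refl) (here refl)         x≢y = contradiction refl x≢y
  two-elements (here _)    (there {xs = _ ∷ _} _) _ = s≤s (s≤s z≤n)
  two-elements (there {xs = _ ∷ _} _) _        _   = s≤s (s≤s z≤n)

  Unique-⊆-length : DecidableEquality A → ∀ {xs ys : List A} → Unique xs →
    (∀ {x} → x ∈ xs → x ∈ ys) → length xs ≤ length ys
  Unique-⊆-length _≟ᴬ_ {[]}     _          _     = z≤n
  Unique-⊆-length _≟ᴬ_ {x ∷ xs} (x∉ ∷ xs!) xs⊆ys =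
    ≤-trans
      (s≤s (Unique-⊆-length _≟ᴬ_ xs! λ u∈ →
        ∈-filter⁺ (¬? ∘ (x ≟ᴬ_)) (xs⊆ys (there u∈)) (All.lookup x∉ u∈)))
      (filter-notAll (¬? ∘ (x ≟ᴬ_)) _ (Any.map (λ x≡y x≢y → x≢y x≡y) (xs⊆ys (here refl))))

  AllPairs-take-drop : ∀ {R : A → A → Set} n {xs x y} → AllPairs R xs →
    x ∈ take n xs → y ∈ drop n xs → R x y
  AllPairs-take-drop (suc n) {_ ∷ _} (Rx ∷ _)  (here refl) y∈ = All.lookup (All.drop⁺ n Rx) y∈
  AllPairs-take-drop (suc n) {_ ∷ _} (_ ∷ Rxs) (there x∈)  y∈ = AllPairs-take-drop n Rxs x∈ y∈

  Unique-resp-↭ : ∀ {xs ys : List A} → xs ↭ ys → Unique xs → Unique ys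
  Unique-resp-↭ = Permutation.Unique-resp-↭ (setoid A) ∘ ↭⇒↭ₛ

  -- Each label of as met at least twice in M uses up two elements of M.
  rare-label : (f : A → ℕ) → ∀ {as} (M : List A) → Unique as → length M < length as + length as →
    ∃ λ a → a ∈ as × length (filter (λ m → f m ≟ a) M) ≤ 1
  rare-label f {a ∷ as} M (a∉ ∷ as!) M< with length (filter (λ m → f m ≟ a) M) ≤? 1
  ... | yes rare = a , here refl , rare
  ... | no  freq =
    let b , b∈ , rare = rare-label f (filter (∁? (λ m → f m ≟ a)) M) as! rest<
    in b , there b∈ ,
       subst (_≤ 1) (cong length (filter-filter-⊆ (∁? (λ m → f m ≟ a)) (λ m → f m ≟ b)
         (λ fm≡b fm≡a → All.lookup a∉ b∈ (trans (sym fm≡a) fm≡b)) M)) rare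
    where
    rest< : length (filter (∁? (λ m → f m ≟ a)) M) < length as + length as
    rest< = +-cancelˡ-< 2 _ _ (begin-strict
      2 + length (filter (∁? (λ m → f m ≟ a)) M)
        ≤⟨ +-monoˡ-≤ _ (≰⇒> freq) ⟩
      length (filter (λ m → f m ≟ a) M) + length (filter (∁? (λ m → f m ≟ a)) M)
        ≡⟨ length-filter-split (λ m → f m ≟ a) M ⟨
      length M
        <⟨ M< ⟩
      suc (length as) + suc (length as)
        ≡⟨ cong suc (+-suc (length as) (length as)) ⟩
      2 + (length as + length as) ∎)
      where open ≤-Reasoning

-- Colour classes in lists of coloured vertices

module _ {X : Set} where

  classOf : ℕ → List (X × ℕ) → List (X × ℕ)
  classOf a = filter (λ e → proj₂ e ≟ a)

  length-classOf-++ : ∀ a E F → length (classOf a (E ++ F)) ≡ length (classOf a E) + length (classOf a F)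
  length-classOf-++ a E F =
    trans (cong length (filter-++ (λ e → proj₂ e ≟ a) E F)) (length-++ (classOf a E))

  -- `F` enters the list twice, so a single occurrence of `a` in `F` would already count as two.
  fresh : ∀ {a} F N → length (classOf a (F ++ F ++ N)) ≤ 1 → length (classOf a F) ≡ 0
  fresh {a} F N rare = halve _ (subst (_≤ 1)
    (trans (length-classOf-++ a F _) (cong (length (classOf a F) +_) (length-classOf-++ a F N))) rare)
    where
    halve : ∀ m {n} → m + (m + n) ≤ 1 → m ≡ 0
    halve zero          _       = refl
    halve (suc zero)    (s≤s ())
    halve (suc (suc _)) (s≤s ())

  classOf-∷-≤1 : ∀ {a} v F → length (classOf a F) ≡ 0 → (∀ b → length (classOf b F) ≤ 1) →
    ∀ b → length (classOf b ((v , a) ∷ F)) ≤ 1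
  classOf-∷-≤1 {a} v F a∉F F≤1 b = case a ≟ b of λ
    { (yes refl) → ≤-reflexive (trans (cong length (filter-accept (λ e → proj₂ e ≟ b) {v , a} {F} refl)) (cong suc a∉F))
    ; (no a≢b)   → subst (_≤ 1) (cong length (sym (filter-reject (λ e → proj₂ e ≟ b) {v , a} {F} a≢b))) (F≤1 b) }

-- Forests, and extending a colouring to a block

module _ {X : Set} {_~_ : X → X → Set} (_~?_ : Decidable _~_) where

  degree : X → List X → ℕ
  degree v R = length (filter (v ~?_) R)

  neighbours : X → List (X × ℕ) → List (X × ℕ)
  neighbours v = filter (λ e → v ~? proj₁ e)

  length-classOf-neighbours : ∀ a v E → length (classOf a (neighbours v E)) ≤ length (classOf a E)
  length-classOf-neighbours a v E =
    length-mono-≤ (⊆-filter⁺ (λ e → proj₂ e ≟ a) (λ e → proj₂ e ≟ a) (λ { refl → λ q → q })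
      (filter-⊆ (λ e → v ~? proj₁ e) E))

  length-neighbours : ∀ v {E R} → map proj₁ E ↭ R → length (neighbours v E) ≡ degree v R
  length-neighbours v {E} E↭R =
    trans (sym (length-filter-map (v ~?_) proj₁ E)) (↭-length (filter-↭ (v ~?_) E↭R))

  -- One copy of `F` bounds the neighbours of `v` inside the block. This supplies the condition of
  -- `Forest` when `v` receives `a`.
  attached : ∀ {a} v F E → length (classOf a (F ++ F ++ neighbours v E)) ≤ 1 →
    length (classOf a (neighbours v (F ++ E))) ≤ 1
  attached {a} v F E rare = begin
    length (classOf a (neighbours v (F ++ E)))
      ≡⟨ cong (length ∘ classOf a) (filter-++ (λ e → v ~? proj₁ e) F E) ⟩
    length (classOf a (neighbours v F ++ neighbours v E))
      ≡⟨ length-classOf-++ a (neighbours v F) _ ⟩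
    length (classOf a (neighbours v F)) + length (classOf a (neighbours v E))
      ≤⟨ +-monoˡ-≤ _ (length-classOf-neighbours a v F) ⟩
    length (classOf a F) + length (classOf a (neighbours v E))
      ≡⟨ length-classOf-++ a F _ ⟨
    length (classOf a (F ++ neighbours v E))
      ≤⟨ m≤n+m _ _ ⟩
    length (classOf a F) + length (classOf a (F ++ neighbours v E))
      ≡⟨ length-classOf-++ a F _ ⟨
    length (classOf a (F ++ F ++ neighbours v E))
      ≤⟨ rare ⟩
    1 ∎
    where open ≤-Reasoning

  -- The head is the vertex coloured last. Each colour class is thus built by adding vertices of
  -- degree at most one, so no cycle ever closes.
  Forest : List (X × ℕ) → Set
  Forest []            = ⊤
  Forest ((v , a) ∷ E) = length (classOf a (neighbours v E)) ≤ 1 × Forest E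

  -- In v ∷ S the vertex v is coloured after S: it must avoid the colours of S, and
  -- each colour occurring at least twice among its neighbours in R.
  data Attachable (k : ℕ) (R : List X) : List X → Set where
    []     : Attachable k R []
    attach : ∀ {v S} i → length S + i ≤ k → degree v R < i + i →
             Attachable k R S → Attachable k R (v ∷ S)

  module _ (L : X → List ℕ) where

    -- `E` keeps the order of colouring, on which `Forest` depends, while `R` keeps an order of its
    -- own; hence the permutation.
    record ColouringOf (R : List X) (E : List (X × ℕ)) : Set where
      field
        vertices : map proj₁ E ↭ R
        listed   : All (λ e → proj₂ e ∈ L (proj₁ e)) E
        forest   : Forest E
    open ColouringOf public

    module _ (k : ℕ) (uniform : ∀ v → Unique (L v) × length (L v) ≡ k) where

      -- Twice `length S` plus the degree is less than twice `length S + i`, hence less than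
      -- `k + k`. Under this bound `rare-label` finds a colour in `L v`.
      forbidden< : ∀ {R S : List X} {E} v F i → length F ≡ length S → length S + i ≤ k → degree v R < i + i →
        ColouringOf R E → length (F ++ F ++ neighbours v E) < length (L v) + length (L v)
      forbidden< {R} {S} {E} v F i |F|≡|S| |S|+i≤k deg< C = begin-strict
        length (F ++ F ++ neighbours v E)
          ≡⟨ trans (length-++ F) (cong (length F +_) (length-++ F)) ⟩
        length F + (length F + length (neighbours v E))
          ≡⟨ cong₂ (λ m n → m + (m + n)) |F|≡|S| (length-neighbours v (vertices C)) ⟩
        length S + (length S + degree v R)
          <⟨ +-monoʳ-< (length S) (+-monoʳ-< (length S) deg<) ⟩
        length S + (length S + (i + i))
          ≡⟨ cong (length S +_) (x∙yz≈y∙xz (length S) i i) ⟩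
        length S + (i + (length S + i))
          ≡⟨ +-assoc (length S) i _ ⟨
        (length S + i) + (length S + i)
          ≤⟨ +-mono-≤ |S|+i≤k |S|+i≤k ⟩
        k + k
          ≡⟨ cong₂ _+_ (proj₂ (uniform v)) (proj₂ (uniform v)) ⟨
        length (L v) + length (L v) ∎
        where
        open ≤-Reasoning
        open CommutativeSemigroupProperties +-commutativeSemigroup using (x∙yz≈y∙xz)

      extend-colouring : ∀ {R S E} → Attachable k R S → ColouringOf R E →
        ∃ λ F → ColouringOf (S ++ R) (F ++ E) × length F ≡ length S × (∀ a → length (classOf a F) ≤ 1)
      extend-colouring [] C = [] , C , refl , λ _ → z≤n
      extend-colouring {R} {v ∷ S} {E} (attach i |S|+i≤k deg< att) C
        with F , C′ , |F|≡|S| , rainbow ← extend-colouring att C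
        -- Since `F` is listed twice, occurring at most once says two things of `a`: no vertex of
        -- the block has it yet, and at most one neighbour of `v` in `E` does.
        with a , a∈Lv , rare ← rare-label proj₂ (F ++ F ++ neighbours v E) (proj₁ (uniform v))
                                 (forbidden< {S = S} v F i |F|≡|S| |S|+i≤k deg< C) =
        (v , a) ∷ F ,
        record { vertices = ↭-prep v (vertices C′)
               ; listed   = a∈Lv ∷ listed C′
               ; forest   = attached v F E rare , forest C′ } ,
        cong suc |F|≡|S| , classOf-∷-≤1 v F (fresh F _ rare) rainbow

-- Equitable colourings by removing blocks

-- Each block raises the bound by exactly one, which pays for the one vertex it may add to a colour
-- class.
ceilDiv-+ : ∀ k m → ceilDiv (suc k + m) (suc k) ≡ suc (ceilDiv m (suc k))
ceilDiv-+ k m = trans (m/n≡1+[m∸n]/n {suc k + m + k} {suc k} (≤-trans (m≤m+n _ m) (m≤m+n _ k)))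
  (cong (λ n → suc (n / suc k)) (trans (cong (_∸ suc k) (+-assoc (suc k) m k)) (m+n∸m≡n (suc k) (m + k))))

ceilDiv-pos : ∀ k m → 1 ≤ ceilDiv (suc m) (suc k)
ceilDiv-pos k m = m≥n⇒m/n>0 (s≤s (m≤n+m k m))

-- `Peelable` is an invariant under which a block can be split off, and it passes to the remainder.
-- For the grid it will be sortedness.
module _ {X : Set} {_~_ : X → X → Set} (_~?_ : Decidable _~_)
         (L : X → List ℕ) (k : ℕ) (uniform : ∀ v → Unique (L v) × length (L v) ≡ suc k)
         (Peelable : List X → Set)
         (peel : ∀ {D} → Peelable D → suc k ≤ length D →
                 ∃₂ λ S R → S ++ R ↭ D × length S ≡ suc k × Attachable _~?_ (suc k) R S × Peelable R)
         where

  EquitableColouring : List X → Set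
  EquitableColouring D = ∃ λ E → ColouringOf _~?_ L D E ×
    (∀ a → length (classOf a E) ≤ ceilDiv (length D) (suc k))

  -- With nothing outside, all degrees are zero and one spare colour suffices. This serves for the
  -- final, incomplete block.
  attachable-[] : ∀ S → length S ≤ suc k → Attachable _~?_ (suc k) [] S
  attachable-[] []      _   = []
  attachable-[] (v ∷ S) S≤k =
    attach 1 (subst (_≤ suc k) (+-comm 1 (length S)) S≤k) (s≤s z≤n)
      (attachable-[] S (≤-trans (n≤1+n _) S≤k))

  empty-colouring : ColouringOf _~?_ L [] []
  empty-colouring = record { vertices = ↭-refl ; listed = [] ; forest = tt }

  extend-equitable : ∀ {S R D} → S ++ R ↭ D → length S ≡ suc k → Attachable _~?_ (suc k) R S →
    EquitableColouring R → EquitableColouring D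
  extend-equitable {S} {R} {D} SR↭D |S|≡k att (E , C , eq) =
    let F , C′ , _ , rainbow = extend-colouring _~?_ L (suc k) uniform att C in
    F ++ E ,
    record { vertices = ↭-trans (vertices C′) SR↭D ; listed = listed C′ ; forest = forest C′ } ,
    λ a → begin
      length (classOf a (F ++ E))                 ≡⟨ length-classOf-++ a F E ⟩
      length (classOf a F) + length (classOf a E) ≤⟨ +-mono-≤ (rainbow a) (eq a) ⟩
      suc (ceilDiv (length R) (suc k))            ≡⟨ ceilDiv-+ k (length R) ⟨
      ceilDiv (suc k + length R) (suc k)          ≡⟨ cong (λ n → ceilDiv (n + length R) (suc k)) |S|≡k ⟨
      ceilDiv (length S + length R) (suc k)       ≡⟨ cong (λ n → ceilDiv n (suc k)) (length-++ S) ⟨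
      ceilDiv (length (S ++ R)) (suc k)           ≡⟨ cong (λ n → ceilDiv n (suc k)) (↭-length SR↭D) ⟩
      ceilDiv (length D) (suc k)                  ∎
    where open ≤-Reasoning

  -- The bound `n` carries the recursion, since `R` is tied to `D` only by a permutation and is no
  -- structural part of it.
  equitable-colouring : ∀ n D → length D ≤ n → Peelable D → EquitableColouring D
  equitable-colouring _ [] _ _ = [] , empty-colouring , λ _ → z≤n
  equitable-colouring (suc n) D@(v ∷ D′) D≤n p with suc k ≤? length D
  ... | yes k≤D =
    let S , R , SR↭D , |S|≡k , att , p′ = peel p k≤D
        |D|≡ = trans (sym (↭-length SR↭D)) (trans (length-++ S) (cong (_+ length R) |S|≡k))
        R≤n = ≤-pred (≤-trans (s≤s (m≤n+m (length R) k)) (subst (_≤ suc n) |D|≡ D≤n))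
    in extend-equitable SR↭D |S|≡k att (equitable-colouring n R R≤n p′)
  -- The leftover vertices get pairwise distinct colours; as `D` is nonempty, the ceiling is at
  -- least one.
  ... | no k≰D =
    let F , C , _ , rainbow = extend-colouring _~?_ L (suc k) uniform
                                (attachable-[] D (≰⇒≥ k≰D)) empty-colouring
    in F ++ [] ,
       record { vertices = ↭-trans (vertices C) (↭-reflexive (++-identityʳ D)) ; listed = listed C ; forest = forest C } ,
       λ a → ≤-trans (≤-reflexive (trans (length-classOf-++ a F []) (+-identityʳ _)))
                     (≤-trans (rainbow a) (ceilDiv-pos k (length D′)))

-- Adjacency and the lexicographic order on ℕ⁴

degree-≤ : ∀ {X : Set} {_~_ : X → X → Set} (_~?_ : Decidable _~_) → DecidableEquality X →
  ∀ {v} {R : List X} N → Unique R → (∀ {u} → u ∈ R → v ~ u → u ∈ N) → degree _~?_ v R ≤ length N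
degree-≤ _~?_ _≟ˣ_ {v} N R! cover = Unique-⊆-length _≟ˣ_ (Unique.filter⁺ (v ~?_) R!) λ u∈ →
  let u∈R , v~u = ∈-filter⁻ (v ~?_) u∈ in cover u∈R v~u

Point : Set
Point = ℕ × ℕ × ℕ × ℕ

_≟ᵖ_ : DecidableEquality Point
_≟ᵖ_ = ≡-dec _≟_ (≡-dec _≟_ (≡-dec _≟_ _≟_))

open DecMembership _≟ᵖ_ using (_∈?_)

next₁ next₂ next₃ next₄ : Point → Point
next₁ (a , b , c , d) = suc a , b , c , d
next₂ (a , b , c , d) = a , suc b , c , d
next₃ (a , b , c , d) = a , b , suc c , d
next₄ (a , b , c , d) = a , b , c , suc d

ups : Point → List Point
ups p = next₁ p ∷ next₂ p ∷ next₃ p ∷ next₄ p ∷ []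

_~_ : Point → Point → Set
p ~ q = q ∈ ups p ⊎ p ∈ ups q

_~?_ : Decidable _~_
p ~? q = (q ∈? ups p) ⊎-dec (p ∈? ups q)

~-irrefl : ∀ {p} → ¬ p ~ p
~-irrefl (inj₁ (there (there (there (there ())))))
~-irrefl (inj₂ (there (there (there (there ())))))

_≺_ : Point → Point → Set
_≺_ = ×-Lex _≡_ _<_ (×-Lex _≡_ _<_ (×-Lex _≡_ _<_ _<_))

≺-asym : Asymmetric _≺_
≺-asym {p} {q} = lex (×-Lex _≡_ _<_ (×-Lex _≡_ _<_ _<_)) (λ {x} {y} → lex (×-Lex _≡_ _<_ _<_) (λ {x} {y} → lex _<_ <-asym {x} {y}) {x} {y}) {p} {q}
  where
  lex : ∀ {B : Set} (_<₂_ : B → B → Set) → (∀ {x y} → x <₂ y → ¬ y <₂ x) →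
    ∀ {x y} → ×-Lex _≡_ _<_ _<₂_ x y → ¬ ×-Lex _≡_ _<_ _<₂_ y x
  lex _ = ×-asymmetric sym (resp₂ _<_) <-asym

≺⇒≢ : ∀ {p q} → p ≺ q → p ≢ q
≺⇒≢ p≺p refl = ≺-asym p≺p p≺p

ups⇒≺ : ∀ {p q} → q ∈ ups p → p ≺ q
ups⇒≺ (here refl)                         = inj₁ (n<1+n _)
ups⇒≺ (there (here refl))                 = inj₂ (refl , inj₁ (n<1+n _))
ups⇒≺ (there (there (here refl)))         = inj₂ (refl , inj₂ (refl , inj₁ (n<1+n _)))
ups⇒≺ (there (there (there (here refl)))) = inj₂ (refl , inj₂ (refl , inj₂ (refl , n<1+n _)))

~-≺⇒ups : ∀ {p q} → p ~ q → p ≺ q → q ∈ ups p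
~-≺⇒ups (inj₁ q∈) _   = q∈
~-≺⇒ups (inj₂ p∈) p≺q = contradiction p≺q (≺-asym (ups⇒≺ p∈))

-- A point between two points that agree in the first three coordinates agrees with them there, and
-- no number lies strictly between `d` and `suc d`.
next₄-covers : ∀ {p q} → p ≺ q → ¬ q ≺ next₄ p
next₄-covers (inj₁ a<a′)                             (inj₁ a′<a)                               = <-asym a<a′ a′<a
next₄-covers (inj₁ a<a′)                             (inj₂ (refl , _))                         = <-irrefl refl a<a′
next₄-covers (inj₂ (refl , _))                       (inj₁ a<a)                                = <-irrefl refl a<a
next₄-covers (inj₂ (_ , inj₁ b<b′))                  (inj₂ (_ , inj₁ b′<b))                    = <-asym b<b′ b′<b
next₄-covers (inj₂ (_ , inj₁ b<b′))                  (inj₂ (_ , inj₂ (refl , _)))              = <-irrefl refl b<b′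
next₄-covers (inj₂ (_ , inj₂ (refl , _)))            (inj₂ (_ , inj₁ b<b))                     = <-irrefl refl b<b
next₄-covers (inj₂ (_ , inj₂ (_ , inj₁ c<c′)))       (inj₂ (_ , inj₂ (_ , inj₁ c′<c)))         = <-asym c<c′ c′<c
next₄-covers (inj₂ (_ , inj₂ (_ , inj₁ c<c′)))       (inj₂ (_ , inj₂ (_ , inj₂ (refl , _))))   = <-irrefl refl c<c′
next₄-covers (inj₂ (_ , inj₂ (_ , inj₂ (refl , _)))) (inj₂ (_ , inj₂ (_ , inj₁ c<c)))          = <-irrefl refl c<c
next₄-covers (inj₂ (_ , inj₂ (_ , inj₂ (_ , d<d′)))) (inj₂ (_ , inj₂ (_ , inj₂ (_ , d′<1+d)))) = <⇒≱ d<d′ (≤-pred d′<1+d)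

Sorted : List Point → Set
Sorted = AllPairs _≺_

sorted⇒unique : ∀ {D} → Sorted D → Unique D
sorted⇒unique = AllPairs.map ≺⇒≢

-- Degrees into a sorted remainder

module _ {R : List Point} (R↗ : Sorted R) where

  private
    bound : ∀ {v} N → (∀ {u} → u ∈ R → v ~ u → u ∈ N) → degree _~?_ v R ≤ length N
    bound N = degree-≤ _~?_ _≟ᵖ_ N (sorted⇒unique R↗)

  -- An edge to a later point raises one coordinate, which leaves four candidates.
  degree-below : ∀ {v} → All (v ≺_) R → degree _~?_ v R ≤ 4
  degree-below {v} v≺R = bound (ups v) λ u∈ v~u → ~-≺⇒ups v~u (All.lookup v≺R u∈)

  -- An element y between v and R prevents the immediate successor of v from lying in R.
  degree-gap : ∀ {v y} → v ≺ y → All (y ≺_) R → All (v ≺_) R → degree _~?_ v R ≤ 3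
  degree-gap {v} {y} v≺y y≺R v≺R = bound (next₁ v ∷ next₂ v ∷ next₃ v ∷ []) λ u∈ v~u →
    cover (All.lookup y≺R u∈) (~-≺⇒ups v~u (All.lookup v≺R u∈))
    where
    cover : ∀ {u} → y ≺ u → u ∈ ups v → u ∈ next₁ v ∷ next₂ v ∷ next₃ v ∷ []
    cover y≺u (here p)                         = here p
    cover y≺u (there (here p))                 = there (here p)
    cover y≺u (there (there (here p)))         = there (there (here p))
    cover y≺u (there (there (there (here refl)))) = contradiction y≺u (next₄-covers v≺y)

  -- Of the four candidates `avoid` excludes `next₂ v` and `next₃ v`, and the point `y` excludes
  -- `next₄ v`.
  degree-corner : ∀ {v y} → v ≺ y → All (y ≺_) R → All (v ≺_) R →
    (∀ {u} → u ∈ R → ¬ u ∈ next₂ v ∷ next₃ v ∷ []) → degree _~?_ v R ≤ 1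
  degree-corner {v} {y} v≺y y≺R v≺R avoid = bound (next₁ v ∷ []) λ u∈ v~u →
    cover (avoid u∈) (All.lookup y≺R u∈) (~-≺⇒ups v~u (All.lookup v≺R u∈))
    where
    cover : ∀ {u} → ¬ u ∈ next₂ v ∷ next₃ v ∷ [] → y ≺ u → u ∈ ups v → u ∈ next₁ v ∷ []
    cover u∉ y≺u (here p)                            = here p
    cover u∉ y≺u (there (here p))                    = contradiction (here p) u∉
    cover u∉ y≺u (there (there (here p)))            = contradiction (there (here p)) u∉
    cover u∉ y≺u (there (there (there (here refl)))) = contradiction y≺u (next₄-covers v≺y)

  -- Of the at most eight neighbours of next₂ x or next₃ x, the vertex x is not in R.
  degree-above : ∀ {x v} → All (x ≺_) R → v ∈ next₂ x ∷ next₃ x ∷ [] → degree _~?_ v R ≤ 7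
  degree-above {x@(a , b , c , d)} {v} x≺R (here refl) =
    -- Four upper candidates and three lower ones, the fourth lower one being `x`. At coordinate
    -- zero `pred` yields a spurious candidate, harmless in an upper bound.
    bound (ups v ++ (pred a , suc b , c , d) ∷ (a , suc b , pred c , d) ∷ (a , suc b , c , pred d) ∷ []) λ
      { u∈ (inj₁ u∈ups) → ∈-++⁺ˡ u∈ups
      ; u∈ (inj₂ v∈ups) → ∈-++⁺ʳ (ups v) (cover (≺⇒≢ (All.lookup x≺R u∈)) v∈ups) }
    where
    cover : ∀ {u} → x ≢ u → v ∈ ups u →
      u ∈ (pred a , suc b , c , d) ∷ (a , suc b , pred c , d) ∷ (a , suc b , c , pred d) ∷ []
    cover x≢u (here refl)                         = here refl
    cover x≢u (there (here refl))                 = contradiction refl x≢u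
    cover x≢u (there (there (here refl)))         = there (here refl)
    cover x≢u (there (there (there (here refl)))) = there (there (here refl))
  degree-above {x@(a , b , c , d)} {v} x≺R (there (here refl)) =
    bound (ups v ++ (pred a , b , suc c , d) ∷ (a , pred b , suc c , d) ∷ (a , b , suc c , pred d) ∷ []) λ
      { u∈ (inj₁ u∈ups) → ∈-++⁺ˡ u∈ups
      ; u∈ (inj₂ v∈ups) → ∈-++⁺ʳ (ups v) (cover (≺⇒≢ (All.lookup x≺R u∈)) v∈ups) }
    where
    cover : ∀ {u} → x ≢ u → v ∈ ups u →
      u ∈ (pred a , b , suc c , d) ∷ (a , pred b , suc c , d) ∷ (a , b , suc c , pred d) ∷ []
    cover x≢u (here refl)                         = here refl
    cover x≢u (there (here refl))                 = there (here refl)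
    cover x≢u (there (there (here refl)))         = contradiction refl x≢u
    cover x≢u (there (there (there (here refl)))) = there (there (here refl))

-- Removing a block from a sorted list

module _ (k : ℕ) where

  private
    -- The fillers are coloured before `x`, `y` and `z`. At most `1 + k` fillers precede any one of
    -- them, leaving four of the `5 + k` colours, and 7 is less than twice four.
    attach-fillers : ∀ {R} S → (∀ {v} → v ∈ S → degree _~?_ v R ≤ 7) → length S ≤ 2 + k →
      Attachable _~?_ (5 + k) R S
    attach-fillers []      _     _   = []
    attach-fillers (v ∷ S) deg≤7 S≤k =
      attach 4 (subst (_≤ 5 + k) (+-comm 4 (length S)) (+-monoʳ-≤ 3 S≤k)) (s≤s (deg≤7 (here refl)))
        (attach-fillers S (deg≤7 ∘ there) (≤-trans (n≤1+n _) S≤k))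

  -- x ∷ y ∷ z ∷ fillers is coloured from the back, so x comes last and has at most one
  -- neighbour outside the block: next₂ x and next₃ x were put into the block, and next₄ x,
  -- if present, comes directly after x.
  attach-block : ∀ x F y z T m → Sorted (x ∷ y ∷ z ∷ T) → (∀ {u} → u ∈ F → u ∈ next₂ x ∷ next₃ x ∷ []) →
    (∀ {u} → u ∈ T → ¬ u ∈ next₂ x ∷ next₃ x ∷ []) → length (F ++ take m T) ≡ 2 + k →
    Attachable _~?_ (5 + k) (drop m T) (x ∷ y ∷ z ∷ F ++ take m T)
  attach-block x F y z T m ((x≺y ∷ x≺z ∷ x≺T) ∷ (y≺z ∷ y≺T) ∷ z≺T ∷ T↗) F⊆ T∩ |fillers| =
    attach 1 (room 1 2 {refl}) (s≤s (degree-corner R↗ x≺y (All.drop⁺ m y≺T) (All.drop⁺ m x≺T) (T∩ ∘ drop⊆)))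
    (attach 2 (room 2 1 {refl}) (s≤s (degree-gap R↗ y≺z (All.drop⁺ m z≺T) (All.drop⁺ m y≺T)))
    (attach 3 (room 3 0 {refl}) (s≤s (≤-trans (degree-below R↗ (All.drop⁺ m z≺T)) (n≤1+n 4)))
    (attach-fillers (F ++ take m T) fillers (≤-reflexive |fillers|))))
    where
    R↗ : Sorted (drop m T)
    R↗ = AllPairs.drop⁺ m T↗

    drop⊆ : ∀ {u} → u ∈ drop m T → u ∈ T
    drop⊆ = subst (_ ∈_) (take++drop≡id m T) ∘ ∈-++⁺ʳ (take m T)

    -- The `2 + k` fillers and `j` of the points `x`, `y`, `z` are coloured earlier, so `i = 3 - j`
    -- of the `5 + k` colours stay free.
    room : ∀ i j {i+j≡3 : i + j ≡ 3} → j + length (F ++ take m T) + i ≤ 5 + k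
    room i j {i+j≡3} = ≤-reflexive (trans (cong (λ n → j + n + i) |fillers|)
      (trans (+-comm (j + (2 + k)) i) (trans (sym (+-assoc i j (2 + k))) (cong (_+ (2 + k)) i+j≡3))))

    fillers : ∀ {v} → v ∈ F ++ take m T → degree _~?_ v (drop m T) ≤ 7
    fillers v∈ with ∈-++⁻ F v∈
    ... | inj₁ v∈F    = degree-above R↗ (All.drop⁺ m x≺T) (F⊆ v∈F)
    ... | inj₂ v∈take = ≤-trans (degree-below R↗ (All.tabulate (AllPairs-take-drop m T↗ v∈take)))
                                (m≤m+n 4 3)

  Block : List Point → Set
  Block D = ∃₂ λ S R → S ++ R ↭ D × length S ≡ 5 + k × Attachable _~?_ (5 + k) R S × Sorted R

  -- At least four points accompany `x` and at most two of them are in `F`, so two remain to serve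
  -- as `y` and `z`. This is where a block size of at least five enters.
  peel-split : ∀ x F T′ {T} → F ++ T′ ↭ T → Sorted (x ∷ T′) →
    (∀ {u} → u ∈ F → u ∈ next₂ x ∷ next₃ x ∷ []) → (∀ {u} → u ∈ T′ → ¬ u ∈ next₂ x ∷ next₃ x ∷ []) →
    length F ≤ 2 → 4 + k ≤ length F + length T′ → Block (x ∷ T)
  peel-split x F [] _ _ _ _ F≤2 k≤ =
    contradiction (≤-trans k≤ (≤-trans (≤-reflexive (+-identityʳ _)) F≤2)) λ { (s≤s (s≤s ())) }
  peel-split x F (y ∷ []) _ _ _ _ F≤2 k≤ =
    contradiction (≤-trans k≤ (+-monoˡ-≤ 1 F≤2)) λ { (s≤s (s≤s (s≤s ()))) }
  peel-split x F (y ∷ z ∷ T) {T₀} FT↭ xyzT↗@(_ ∷ _ ∷ _ ∷ T↗) F⊆ T∩ F≤2 k≤ =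
    x ∷ y ∷ z ∷ F ++ take m T , drop m T ,
    ↭-prep x (↭-trans rearrange FT↭) , cong (3 +_) |fillers| ,
    attach-block x F y z T m xyzT↗ F⊆ (T∩ ∘ there ∘ there) |fillers| ,
    AllPairs.drop⁺ m T↗
    where
    -- The least points of `T` complete `F` to `2 + k` fillers; the subtraction is exact because `F`
    -- has at most two elements.
    m = 2 + k ∸ length F

    m≤T : m ≤ length T
    m≤T = m≤n+o⇒m∸n≤o (2 + k) (length F) (≤-pred (≤-pred (≤-trans k≤
      (≤-reflexive (trans (+-suc (length F) _) (cong suc (+-suc (length F) _)))))))

    |fillers| : length (F ++ take m T) ≡ 2 + k
    |fillers| = begin
      length (F ++ take m T)         ≡⟨ length-++ F ⟩
      length F + length (take m T)   ≡⟨ cong (length F +_) (trans (length-take m T) (m≤n⇒m⊓n≡m m≤T)) ⟩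
      length F + (2 + k ∸ length F)  ≡⟨ m+[n∸m]≡n (≤-trans F≤2 (m≤m+n 2 k)) ⟩
      2 + k                          ∎
      where open ≡-Reasoning

    rearrange : y ∷ z ∷ (F ++ take m T) ++ drop m T ↭ F ++ y ∷ z ∷ T
    rearrange = begin
      y ∷ z ∷ (F ++ take m T) ++ drop m T ≡⟨ cong (λ t → y ∷ z ∷ t) (++-assoc F (take m T) (drop m T)) ⟩
      y ∷ z ∷ F ++ take m T ++ drop m T   ≡⟨ cong (λ t → y ∷ z ∷ F ++ t) (take++drop≡id m T) ⟩
      y ∷ z ∷ F ++ T                      ↭⟨ ↭-prep y (↭-sym (shift z F T)) ⟩
      y ∷ F ++ z ∷ T                      ↭⟨ ↭-sym (shift y F (z ∷ T)) ⟩
      F ++ y ∷ z ∷ T                      ∎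
      where open PermutationReasoning

  peel : ∀ {D} → Sorted D → 5 + k ≤ length D → Block D
  peel {x ∷ T} (x≺T ∷ T↗) (s≤s k≤) =
    peel-split x (filter near? T) (filter (∁? near?) T) (↭-sym (filter-split-↭ near? T))
      (All.filter⁺ (∁? near?) x≺T ∷ AllPairs.filter⁺ (∁? near?) T↗)
      (proj₂ ∘ ∈-filter⁻ near? {xs = T}) (proj₂ ∘ ∈-filter⁻ (∁? near?) {xs = T})
      (Unique-⊆-length _≟ᵖ_ (Unique.filter⁺ near? (sorted⇒unique T↗)) (proj₂ ∘ ∈-filter⁻ near? {xs = T}))
      (≤-trans k≤ (≤-reflexive (length-filter-split near? T)))
    where
    near? : Unary.Decidable (_∈ next₂ x ∷ next₃ x ∷ [])
    near? = _∈? next₂ x ∷ next₃ x ∷ []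

-- Forests contain no cycles

TwoNeighbours : {X : Set} → (X → X → Set) → List X → X → Set
TwoNeighbours _~_ C v = ∃₂ λ u w → u ∈ C × w ∈ C × u ≢ w × v ~ u × v ~ w

module _ {X : Set} {_~_ : X → X → Set} (_~?_ : Decidable _~_) (_≟ˣ_ : DecidableEquality X)
         (irrefl : ∀ {v} → ¬ v ~ v) where

  -- Consider the vertex of `C` met first in `E` with colour `a`, that is, coloured last. Its two
  -- neighbours in `C` lie further down with the same colour, against `Forest`.
  forest-acyclic : ∀ {a E C x} → Forest _~?_ E → x ∈ C → (∀ {v} → v ∈ C → TwoNeighbours _~_ C v) →
    ¬ (∀ {v} → v ∈ C → (v , a) ∈ E)
  forest-acyclic {E = []} _ x∈C _ C⊆E = case C⊆E x∈C of λ ()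
  forest-acyclic {a} {(y , b) ∷ E} {C} (friends≤1 , forest) x∈C two C⊆E
    with ≡-dec _≟ˣ_ _≟_ (y , a) (y , b) | DecMembership._∈?_ _≟ˣ_ y C
  ... | yes refl | yes y∈C =
    let u , w , u∈C , w∈C , u≢w , y~u , y~w = two y∈C
    in <⇒≱ (two-elements (friend u∈C y~u) (friend w∈C y~w) (u≢w ∘ cong proj₁)) friends≤1
    where
    friend : ∀ {u} → u ∈ C → y ~ u → (u , a) ∈ classOf a (neighbours _~?_ y E)
    friend u∈C y~u with C⊆E u∈C
    ... | here refl = contradiction y~u irrefl
    ... | there u∈E = ∈-filter⁺ (λ e → proj₂ e ≟ a) (∈-filter⁺ (λ e → y ~? proj₁ e) u∈E y~u) refl
  ... | yes refl | no y∉C = forest-acyclic forest x∈C two λ v∈C →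
    case C⊆E v∈C of λ { (here refl) → contradiction v∈C y∉C ; (there v∈E) → v∈E }
  ... | no a≢b | _ = forest-acyclic forest x∈C two λ v∈C →
    case C⊆E v∈C of λ { (here refl) → contradiction refl a≢b ; (there v∈E) → v∈E }

-- Neighbours along a cycle

lookup-injective : ∀ {A : Set} {xs : List A} → Unique xs → ∀ i j → lookup xs i ≡ lookup xs j → i ≡ j
lookup-injective (x∉ ∷ xs!) zero    zero    _  = refl
lookup-injective (x∉ ∷ xs!) zero    (suc j) eq = contradiction eq (All.lookup x∉ (∈-lookup j))
lookup-injective (x∉ ∷ xs!) (suc i) zero    eq = contradiction (sym eq) (All.lookup x∉ (∈-lookup i))
lookup-injective (x∉ ∷ xs!) (suc i) (suc j) eq = cong suc (lookup-injective xs! i j eq)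

module _ {G : Graph} {S : V G → Set} (cycle : CycleIn G S) where
  open CycleIn cycle

  private
    n = length cyc

    at : ∀ {m} → m < n → V G
    at m<n = lookup cyc (fromℕ< m<n)

    at-≢ : ∀ {l m} (l<n : l < n) (m<n : m < n) → l ≢ m → at l<n ≢ at m<n
    at-≢ l<n m<n l≢m eq = l≢m (trans (sym (toℕ-fromℕ< l<n))
      (trans (cong toℕ (lookup-injective distinct _ _ eq)) (toℕ-fromℕ< m<n)))

    adj : ∀ {m} (m<n : m < n) (1+m<n : suc m < n) → Adj G (at m<n) (at 1+m<n)
    adj m<n = adj′ (fromℕ< m<n) (toℕ-fromℕ< m<n)
      where
      -- A variable index lets `toℕ i ≡ m` be matched, so that the bound has the type that
      -- `adjacent` expects.
      adj′ : ∀ {m} (i : Fin n) → toℕ i ≡ m → (1+m<n : suc m < n) → Adj G (lookup cyc i) (at 1+m<n)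
      adj′ i refl = adjacent i

    0<n : 0 < n
    0<n = ≤-trans (s≤s z≤n) long

    last<n : n ∸ 1 < n
    last<n = ∸-monoʳ-< {n} (s≤s z≤n) 0<n

    last-adj : ∀ {m} (m<n : m < n) → suc m ≡ n → Adj G (at m<n) (at 0<n)
    last-adj m<n 1+m≡n = subst (λ i → Adj G (lookup cyc i) (at 0<n))
      (toℕ-injective (trans (toℕ-fromℕ< last<n) (trans (cong (_∸ 1) (sym 1+m≡n)) (sym (toℕ-fromℕ< m<n)))))
      (closing 0<n last<n)

    -- The two neighbours are the cyclic predecessor and successor. At the ends the pairs of
    -- positions are `n - 1`, `1` and `n - 2`, `0`, distinct because `n` is at least 3.
    around : ∀ m (m<n : m < n) →
      ∃₂ λ u w → u ∈ cyc × w ∈ cyc × u ≢ w × Adj G u (at m<n) × Adj G (at m<n) w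
    around zero 0<n′ =
      at last<n , at 1<n , ∈-lookup _ , ∈-lookup _ , at-≢ last<n 1<n (>⇒≢ (∸-monoˡ-≤ 1 long)) ,
      closing 0<n′ last<n , adj 0<n′ 1<n
      where
      1<n = ≤-trans (s≤s (s≤s z≤n)) long
    around (suc l) m<n with suc (suc l) <? n
    ... | yes 1+m<n =
      at l<n , at 1+m<n , ∈-lookup _ , ∈-lookup _ , at-≢ l<n 1+m<n (m≢1+n+m l) ,
      adj l<n m<n , adj m<n 1+m<n
      where
      l<n = <-trans (n<1+n l) m<n
    ... | no 1+m≮n =
      at l<n , at 0<n , ∈-lookup _ , ∈-lookup _ , at-≢ l<n 0<n l≢0 ,
      adj l<n m<n , last-adj m<n 1+m≡n
      where
      l<n = <-trans (n<1+n l) m<n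
      1+m≡n = ≤-antisym m<n (≮⇒≥ 1+m≮n)
      l≢0 : l ≢ 0
      l≢0 l≡0 = contradiction (subst (3 ≤_) (trans (sym 1+m≡n) (cong (2 +_) l≡0)) long) λ { (s≤s (s≤s ())) }

  cycle-two-neighbours : ∀ {v} → v ∈ cyc →
    ∃₂ λ u w → u ∈ cyc × w ∈ cyc × u ≢ w × Adj G u v × Adj G v w
  cycle-two-neighbours v∈ =
    subst (λ v → ∃₂ λ u w → u ∈ cyc × w ∈ cyc × u ≢ w × Adj G u v × Adj G v w)
      (trans (cong (lookup cyc) (fromℕ<-toℕ i (toℕ<n i))) (sym (lookup-index v∈)))
      (around (toℕ i) (toℕ<n i))
    where
    i = Any.index v∈

-- Reading a colour function off a list

lookupColour : ∀ {X : Set} → DecidableEquality X → List (X × ℕ) → X → ℕ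
lookupColour _≟ˣ_ []            x = 0
lookupColour _≟ˣ_ ((y , a) ∷ E) x with y ≟ˣ x
... | yes _ = a
... | no  _ = lookupColour _≟ˣ_ E x

lookupColour-∈ : ∀ {X : Set} (_≟ˣ_ : DecidableEquality X) {E x a} → Unique (map proj₁ E) →
  (x , a) ∈ E → lookupColour _≟ˣ_ E x ≡ a
lookupColour-∈ _≟ˣ_ {(y , _) ∷ E} {x} (y∉ ∷ E!) xa∈ with y ≟ˣ x | xa∈
... | yes _    | here refl  = refl
... | yes refl | there xa∈E = contradiction refl (All.lookup y∉ (∈-map⁺ proj₁ xa∈E))
... | no y≢x   | here refl  = contradiction refl y≢x
... | no _     | there xa∈E = lookupColour-∈ _≟ˣ_ E! xa∈E

-- The grid inside ℕ⁴

-- A left inverse of `toℕ` defined on all of ℕ, so that every point of ℕ⁴ inherits a list from some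
-- grid vertex.
clamp : ∀ n → ℕ → Fin (suc n)
clamp n       zero    = zero
clamp zero    (suc m) = zero
clamp (suc n) (suc m) = suc (clamp n m)

clamp-toℕ : ∀ {n} (i : Fin (suc n)) → clamp n (toℕ i) ≡ i
clamp-toℕ         zero    = refl
clamp-toℕ {suc n} (suc i) = cong suc (clamp-toℕ i)

-- The pairs starting with `x` come first, ordered by their second components, and `x` is below
-- every later first component.
cartesianProduct-Lex : ∀ {A B : Set} {_≈₁_ _<₁_ : A → A → Set} {_<₂_ : B → B → Set} → (∀ {x} → x ≈₁ x) →
  ∀ {xs ys} → AllPairs _<₁_ xs → AllPairs _<₂_ ys →
  AllPairs (×-Lex _≈₁_ _<₁_ _<₂_) (cartesianProduct xs ys)
cartesianProduct-Lex refl₁ []            ys↗ = []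
cartesianProduct-Lex refl₁ {x ∷ xs} {ys} (x<xs ∷ xs↗) ys↗ =
  AllPairs.++⁺ (AllPairs.map⁺ (AllPairs.map (λ y<y′ → inj₂ (refl₁ , y<y′)) ys↗))
    (cartesianProduct-Lex refl₁ xs↗ ys↗)
    (All.map⁺ (All.tabulate λ _ → All.tabulate λ p∈ →
      inj₁ (All.lookup x<xs (proj₁ (∈-cartesianProduct⁻ xs ys p∈)))))

module _ (m₁ m₂ m₃ m₄ : ℕ) where

  private
    G = Grid4 (suc m₁) (suc m₂) (suc m₃) (suc m₄)

  coordinates : V G → Point
  coordinates (i , j , l , h) = toℕ i , toℕ j , toℕ l , toℕ h

  vertexAt : Point → V G
  vertexAt (a , b , c , d) = clamp m₁ a , clamp m₂ b , clamp m₃ c , clamp m₄ d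

  vertexAt-coordinates : ∀ v → vertexAt (coordinates v) ≡ v
  vertexAt-coordinates (i , j , l , h) =
    cong₂ _,_ (clamp-toℕ i) (cong₂ _,_ (clamp-toℕ j) (cong₂ _,_ (clamp-toℕ l) (clamp-toℕ h)))

  coordinates-injective : ∀ {u v} → coordinates u ≡ coordinates v → u ≡ v
  coordinates-injective {u} {v} eq =
    trans (sym (vertexAt-coordinates u)) (trans (cong vertexAt eq) (vertexAt-coordinates v))

  grid-sorted : Sorted (map coordinates (verts G))
  grid-sorted = AllPairs.map⁺
    (cartesianProduct-Lex refl (path↗ (suc m₁)) (cartesianProduct-Lex refl (path↗ (suc m₂))
      (cartesianProduct-Lex refl (path↗ (suc m₃)) (path↗ (suc m₄)))))
    where
    path↗ : ∀ n → AllPairs (_<_ on toℕ) (allFin n)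
    path↗ n = AllPairs.tabulate⁺-< λ i<j → i<j

  verts-complete : ∀ v → v ∈ verts G
  verts-complete (i , j , l , h) = ∈-cartesianProduct⁺ (∈-allFin i)
    (∈-cartesianProduct⁺ (∈-allFin j) (∈-cartesianProduct⁺ (∈-allFin l) (∈-allFin h)))

  Adj⇒~ : ∀ {u v} → Adj G u v → coordinates u ~ coordinates v
  Adj⇒~ (inj₁ (inj₁ eq , refl)) rewrite eq = inj₁ (here refl)
  Adj⇒~ (inj₁ (inj₂ eq , refl)) rewrite eq = inj₂ (here refl)
  Adj⇒~ (inj₂ (refl , inj₁ (inj₁ eq , refl))) rewrite eq = inj₁ (there (here refl))
  Adj⇒~ (inj₂ (refl , inj₁ (inj₂ eq , refl))) rewrite eq = inj₂ (there (here refl))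
  Adj⇒~ (inj₂ (refl , inj₂ (refl , inj₁ (inj₁ eq , refl)))) rewrite eq = inj₁ (there (there (here refl)))
  Adj⇒~ (inj₂ (refl , inj₂ (refl , inj₁ (inj₂ eq , refl)))) rewrite eq = inj₂ (there (there (here refl)))
  Adj⇒~ (inj₂ (refl , inj₂ (refl , inj₂ (refl , inj₁ eq)))) rewrite eq = inj₁ (there (there (there (here refl))))
  Adj⇒~ (inj₂ (refl , inj₂ (refl , inj₂ (refl , inj₂ eq)))) rewrite eq = inj₂ (there (there (there (here refl))))

  -- Transfer of the colouring to the grid

  grid-arborable : ∀ k → EquitablyListArborable G (5 + k)
  grid-arborable k (L , uniform) = c , c-listed , c-equitable , c-acyclic
    where
    D = map coordinates (verts G)

    solution : ∃ λ E → ColouringOf _~?_ (L ∘ vertexAt) D E ×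
      (∀ a → length (classOf a E) ≤ ceilDiv (length D) (5 + k))
    solution = equitable-colouring _~?_ (L ∘ vertexAt) (4 + k) (uniform ∘ vertexAt) Sorted (peel k)
      (length D) D ≤-refl grid-sorted

    E = proj₁ solution
    C = proj₁ (proj₂ solution)

    κ : Point → ℕ
    κ = lookupColour _≟ᵖ_ E

    c : V G → ℕ
    c = κ ∘ coordinates

    -- The vertices of `E` are a permutation of a strictly sorted list, so each point has only one
    -- entry.
    κ-∈ : ∀ {p a} → (p , a) ∈ E → κ p ≡ a
    κ-∈ = lookupColour-∈ _≟ᵖ_ (Unique-resp-↭ (↭-sym (vertices C)) (sorted⇒unique grid-sorted))

    coloured : ∀ v → (coordinates v , c v) ∈ E
    coloured v with ∈-map⁻ proj₁ (∈-resp-↭ (↭-sym (vertices C)) (∈-map⁺ coordinates (verts-complete v)))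
    ... | (p , a) , pa∈E , refl = subst (λ b → (p , b) ∈ E) (sym (κ-∈ pa∈E)) pa∈E

    c-listed : ∀ v → c v ∈ L v
    c-listed v = subst (λ u → c v ∈ L u) (vertexAt-coordinates v) (All.lookup (listed C) (coloured v))

    c-equitable : ∀ a → classSize G c a ≤ ceilDiv (length (verts G)) (5 + k)
    c-equitable a = begin
      classSize G c a
        ≡⟨ length-filter-map (λ p → κ p ≟ a) coordinates (verts G) ⟨
      length (filter (λ p → κ p ≟ a) D)
        ≡⟨ ↭-length (filter-↭ (λ p → κ p ≟ a) (vertices C)) ⟨
      length (filter (λ p → κ p ≟ a) (map proj₁ E))
        ≡⟨ length-filter-map (λ p → κ p ≟ a) proj₁ E ⟩
      length (filter (λ e → κ (proj₁ e) ≟ a) E)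
        -- On the entries of `E` the function `κ` returns the stored colour.
        ≤⟨ length-filter-mono (λ e → κ (proj₁ e) ≟ a) (λ e → proj₂ e ≟ a) (λ e∈E eq → trans (sym (κ-∈ e∈E)) eq) ⟩
      length (classOf a E)
        ≤⟨ proj₂ (proj₂ solution) a ⟩
      ceilDiv (length D) (5 + k)
        ≡⟨ cong (λ n → ceilDiv n (5 + k)) (length-map coordinates (verts G)) ⟩
      ceilDiv (length (verts G)) (5 + k) ∎
      where open ≤-Reasoning

    c-acyclic : ∀ a → InducesAcyclic G (λ v → c v ≡ a)
    -- In coordinates, a monochromatic cycle is a nonempty set of points that all occur in `E` with
    -- colour `a`, each having two neighbours in the set.
    c-acyclic a cycle = forest-acyclic _~?_ _≟ᵖ_ ~-irrefl (forest C)
      (∈-map⁺ coordinates (∈-lookup (fromℕ< {0} (≤-trans (s≤s z≤n) (CycleIn.long cycle)))))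
      two-neighbours
      λ p∈ → case ∈-map⁻ coordinates p∈ of λ
        { (v , v∈ , refl) → subst (λ b → (coordinates v , b) ∈ E) (CycleIn.inS cycle v∈) (coloured v) }
      where
      cyc = map coordinates (CycleIn.cyc cycle)

      two-neighbours : ∀ {p} → p ∈ cyc → TwoNeighbours _~_ cyc p
      two-neighbours p∈ with ∈-map⁻ coordinates p∈
      ... | v , v∈ , refl with u , w , u∈ , w∈ , u≢w , u~v , v~w ← cycle-two-neighbours cycle v∈ =
        coordinates u , coordinates w , ∈-map⁺ coordinates u∈ , ∈-map⁺ coordinates w∈ ,
        u≢w ∘ coordinates-injective , Sum.swap (Adj⇒~ u~v) , Adj⇒~ v~w

theorem13 : (k : ℕ) → 5 ≤ k →
    (n₁ n₂ n₃ n₄ : ℕ) → 2 ≤ n₁ → 2 ≤ n₂ → 2 ≤ n₃ → 2 ≤ n₄ →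
    EquitablyListArborable (Grid4 n₁ n₂ n₃ n₄) k
theorem13 k 5≤k (suc m₁) (suc m₂) (suc m₃) (suc m₄) _ _ _ _ =
  -- Blocks have size `5 + k′` with `k′ = k ∸ 5`.
  subst (EquitablyListArborable _) (m+[n∸m]≡n 5≤k) (grid-arborable m₁ m₂ m₃ m₄ (k ∸ 5))
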